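{- Let $r\ge 3$ be an integer and let $\sigma$ be a partition of $r$ with $s=s(\sigma)\ge 2$ parts, with $\delta(\sigma)=1$ and with largest part $\Delta=\Delta(\sigma)>1$. Let $n$ be an integer with $n>r(s-1)+s$, let $q=(r-1)(\Delta-1)$, and let $\mathcal{H}=\mathcal{H}(n,r,q|\sigma)$. Then $\mathcal{H}$ has a gap in its NMNR spectrum between $r-1$ and $\lceil n/(s-1)\rceil$. More specifically: (1) $\mathcal{H}$ is not $k$-NMNR colourable for any positive integer $k\le r-2$; (2) $\mathcal{H}$ is $(r-1)$-NMNR colourable; (3) $\mathcal{H}$ is not $r$-NMNR colourable; (4) $\mathcal{H}$ is $k$-NMNR colourable for every integer $k$ with $\lceil n/(s-1)\rceil\le k\le n$.
   Context: For positive integers $n,r,q$ with $r\ge 3$ and a partition $\sigma$ of the integer $r$ (into positive parts), the $\sigma$-hypergraph $\mathcal{H}(n,r,q|\sigma)$ has $nq$ vertices, partitioned into $n$ classes $V_1,\dots,V_n$ each containing $q$ vertices; an $r$-subset $R$ of the vertices is an edge if and only if the non-zero cardinalities among $|R\cap V_i|$, $1\le i\le n$, form (as a multiset) the partition $\sigma$ of $r$. $\Delta(\sigma)$, $\delta(\sigma)$ and $s(\sigma)$ denote the size of the largest part, the size of the smallest part, and the number of parts (counted with multiplicity) of $\sigma$, respectively. It is assumed throughout that $s(\sigma)\ge 2$. A $k$-NMNR (non-monochromatic non-rainbow) colouring of a hypergraph is a colouring of its vertices using exactly $k$ distinct colours (all $k$ are used) such that no edge has all its vertices of the same colour and no edge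 has all its vertices of pairwise distinct colours. A hypergraph is $k$-NMNR colourable if it has a $k$-NMNR colouring. Its NMNR spectrum is the set of all positive integers $k$ for which it is $k$-NMNR colourable; the spectrum has a gap if there are $k_1<k_2<k_3$ with $k_1,k_3$ in the spectrum and $k_2$ not in the spectrum. -}

module Defs where

open import Data.Fin.Base using (Fin; quotient)
import Data.Fin.Properties as Fin
open import Data.Fin.Subset using (Subset; _∈_; _∩_; ∣_∣)
open import Data.List.Base using (List; length; map; filter; allFin)
open import Data.List.Extrema.Nat using (max; min)
open import Data.List.Relation.Binary.Permutation.Propositional using (_↭_)
open import Data.List.Relation.Unary.All using (All)
open import Data.Nat.Base using (ℕ; _+_; _*_; _∸_; _/_; _≤_; _<_; NonZero; >-nonZero)
open import Data.Nat.ListAction using (sum)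
open import Data.Nat.Properties using (nonZero?; m<n⇒0<n∸m)
open import Data.Product.Base using (_×_; ∃-syntax)
open import Data.Vec.Base using (tabulate)
open import Function.Definitions using (Surjective)
open import Relation.Binary.PropositionalEquality using (_≡_)
open import Relation.Nullary using (¬_; does)

-- The list of parts is only ever used up to permutation.
record Partition (r : ℕ) : Set where
  field
    parts    : List ℕ
    positive : All NonZero parts
    total    : sum parts ≡ r

open Partition public

Δ : ∀ {r} → Partition r → ℕ
Δ σ = max 0 (parts σ)

-- The first argument of min is only a default: no part exceeds r, so as soon
-- as there is a part this is the smallest one.
δ : ∀ {r} → Partition r → ℕ
δ {r} σ = min r (parts σ)

s : ∀ {r} → Partition r → ℕ
s σ = length (parts σ)

record Hypergraph : Set₁ where
  field
    order : ℕ
    Edge  : Subset order → Set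

open Hypergraph public

-- The nq vertices are numbered so that class i consists of the q consecutive
-- vertices iq , … , iq + q - 1.
V : ∀ n q → Fin n → Subset (n * q)
V n q i = tabulate λ v → does (quotient q v Fin.≟ i)

intersectionSizes : ∀ n q → Subset (n * q) → List ℕ
intersectionSizes n q R = map (λ i → ∣ R ∩ V n q i ∣) (allFin n)

ℋ : ∀ n r q → Partition r → Hypergraph
ℋ n r q σ = record
  { order = n * q
  ; Edge  = λ R → ∣ R ∣ ≡ r × filter nonZero? (intersectionSizes n q R) ↭ parts σ
  }

module _ {m k : ℕ} (c : Fin m → Fin k) where

  Monochromatic : Subset m → Set
  Monochromatic R = ∀ u v → u ∈ R → v ∈ R → c u ≡ c v

  Rainbow : Subset m → Set
  Rainbow R = ∀ u v → u ∈ R → v ∈ R → c u ≡ c v → u ≡ v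

record IsNMNR (H : Hypergraph) {k : ℕ} (c : Fin (order H) → Fin k) : Set where
  field
    allUsed          : Surjective _≡_ _≡_ c
    nonMonochromatic : ∀ R → Edge H R → ¬ Monochromatic c R
    nonRainbow       : ∀ R → Edge H R → ¬ Rainbow c R

NMNRColourable : ℕ → Hypergraph → Set
NMNRColourable k H = ∃[ c ] IsNMNR H {k} c

NMNRSpectrum : Hypergraph → ℕ → Set
NMNRSpectrum H k = 1 ≤ k × NMNRColourable k H

GapBetween : Hypergraph → ℕ → ℕ → Set
GapBetween H k₁ k₃ =
  NMNRSpectrum H k₁ × NMNRSpectrum H k₃ ×
  ∃[ k₂ ] (k₁ < k₂ × k₂ < k₃ × ¬ NMNRSpectrum H k₂)

⌈_/_⌉ : (m d : ℕ) .{{_ : NonZero d}} → ℕ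
⌈ m / d ⌉ = (m + (d ∸ 1)) / d

n≥2⇒n∸1-nonZero : ∀ {n} → 2 ≤ n → NonZero (n ∸ 1)
n≥2⇒n∸1-nonZero 2≤n = >-nonZero (m<n⇒0<n∸m 2≤n)

{-# OPTIONS --safe #-}
-- A vertex colouring forbids monochromatic edges as soon as no class contains Δ vertices of one colour, or as soon
-- as classes are monochromatic and no colour fills s classes; this gives the colourings with r - 1 colours (each
-- colour Δ - 1 times in each class) and with ⌈n/(s-1)⌉ ≤ k ≤ n colours (class i coloured by i mod k).
-- Conversely, in a colouring without monochromatic edge every colour is heavy (used at least Δ times) in fewer than
-- s classes.  With k ≤ r - 2 colours every class has a heavy colour, so n ≤ k(s - 1), which is false.  With r colours
-- at least s classes have no heavy colour, and each of these misses at most one colour.  Let A be such a class, and v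
-- a vertex outside A whose colour c is the one missing from A (if A misses none, any v).  Taking v as a part of size
-- 1, choosing new colours other than c greedily in further such classes, and leaving the last colours for A gives a
-- rainbow edge.

module Submission where

open import Defs
open import Algebra.Properties.CommutativeSemigroup using (x∙yz≈y∙xz)
open import Data.Bool.Base using (true; false)
open import Data.Fin.Base using (Fin; zero; suc; combine; fromℕ<; inject≤; quotient; remainder)
import Data.Fin.Properties as Fin
open import Data.Fin.Subset as Subset using (Subset; _∩_; ∣_∣)
open import Data.Fin.Subset.Properties using (x∈p∩q⁺; x∈p∩q⁻)
open import Data.List.Base using (List; []; _∷_; _++_; length; map; filter; concatMap; allFin; take)
open import Data.List.Extrema.Nat using (argmax-sel; argmin-sel; xs≤max)
import Data.List.Membership.DecPropositional as DecMembership
open import Data.List.Membership.Propositional using (_∈_; _∉_)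
open import Data.List.Membership.Propositional.Properties
  using (∈-∃++; ∈-AllPairs₂; ∈-map⁺; ∈-map⁻; ∈-allFin; ∈-++⁻; ∈-++⁺ˡ; ∈-++⁺ʳ; ∈-filter⁺; ∈-filter⁻; ∈-concatMap⁺)
open import Data.List.Membership.Propositional.Properties.WithK using (unique∧set⇒bag)
open import Data.List.Properties
  using (length-tabulate; length-map; length-take; length-++; length-++-sucʳ; map-∘; map-cong-local; map-++; ++-assoc)
open import Data.List.Relation.Binary.BagAndSetEquality using (∼bag⇒↭)
open import Data.List.Relation.Binary.Permutation.Propositional
  using (_↭_; ↭-trans; ↭-sym; ↭-reflexive; ↭-refl; ↭-prep; ↭⇒↭ₛ; module PermutationReasoning)
import Data.List.Relation.Binary.Permutation.Propositional.Properties as ↭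
import Data.List.Relation.Binary.Permutation.Setoid.Properties as ↭ₛ
open import Data.List.Relation.Binary.Subset.Propositional using (_⊆_)
open import Data.List.Relation.Unary.All as All using (All; []; _∷_)
open import Data.List.Relation.Unary.All.Properties as All using (all-filter)
open import Data.List.Relation.Unary.AllPairs using ([]; _∷_)
import Data.List.Relation.Unary.AllPairs.Properties as AllPairs
open import Data.List.Relation.Unary.Any as Any using (here; there)
open import Data.List.Relation.Unary.Unique.Propositional using (Unique)
open import Data.List.Relation.Unary.Unique.Propositional.Properties as Unique using (allFin⁺; filter⁺)
open import Data.Nat.Base
  using (ℕ; suc; _+_; _*_; _/_; _%_; _∸_; _≤_; _<_; z≤n; s≤s; s≤s⁻¹; NonZero; >-nonZero; >-nonZero⁻¹; ≢-nonZero⁻¹)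
open import Data.Nat.DivMod using (m≡m%n+[m/n]*n; m%n<n; m*n/n≡m; /-monoˡ-≤)
open import Data.Nat.ListAction using (sum)
open import Data.Nat.ListAction.Properties using (sum-↭)
open import Data.Nat.Properties
open import Data.Product.Base using (∃-syntax; Σ-syntax; _×_; _,_; proj₁; proj₂)
open import Data.Sum.Base using (_⊎_; inj₁; inj₂)
open import Data.Vec.Base as Vec using (here; there)
open import Data.Vec.Properties using (lookup∘tabulate; []=⇒lookup; lookup⇒[]=)
open import Function.Base using (id; _∘_)
open import Function.Bundles using (mk⇔)
open import Function.Definitions using (Surjective)
open import Level using (0ℓ)
open import Relation.Binary.PropositionalEquality
open import Relation.Nullary using (¬_; Dec; yes; no; does; contradiction)
open import Relation.Nullary.Decidable using (dec-true; ¬?)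
open import Relation.Unary using (Decidable; Pred)
open import Relation.Unary.Properties using (∁?)

open module Membership {m} = DecMembership (Fin._≟_ {m}) using (_∈?_)

-- Counting with duplicate-free lists.

private variable
  A B C : Set

Unique-resp-↭ : {xs ys : List A} → xs ↭ ys → Unique xs → Unique ys
Unique-resp-↭ {A = A} = ↭ₛ.Unique-resp-↭ (setoid A) ∘ ↭⇒↭ₛ

-- Deleting the head of `xs` from `ys` keeps the tail of `xs` inside, because the head does not
-- recur in that tail.
length-mono-⊆ : {xs ys : List A} → Unique xs → xs ⊆ ys → length xs ≤ length ys
length-mono-⊆ []       _   = z≤n
length-mono-⊆ {xs = x ∷ xs} (x∉ ∷ u) sub with ∈-∃++ (sub (here refl))
... | ys , zs , refl = ≤-trans (s≤s (length-mono-⊆ u sub′)) (≤-reflexive (sym (length-++-sucʳ ys x zs)))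
  where
  sub′ : xs ⊆ ys ++ zs
  sub′ y∈xs with ∈-++⁻ ys (sub (there y∈xs))
  ... | inj₁ y∈ys           = ∈-++⁺ˡ y∈ys
  ... | inj₂ (here refl)    = contradiction refl (All.lookup x∉ y∈xs)
  ... | inj₂ (there y∈zs)   = ∈-++⁺ʳ ys y∈zs

unique-↭ : {xs ys : List A} → Unique xs → Unique ys → xs ⊆ ys → ys ⊆ xs → xs ↭ ys
unique-↭ uxs uys xs⊆ys ys⊆xs = ∼bag⇒↭ (unique∧set⇒bag uxs uys (mk⇔ xs⊆ys ys⊆xs))

length-concatMap-≤ : ∀ (f : A → List B) {t} xs → (∀ x → length (f x) ≤ t) →
                     length (concatMap f xs) ≤ length xs * t
length-concatMap-≤ f []       _  = z≤n
length-concatMap-≤ f (x ∷ xs) ≤t =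
  ≤-trans (≤-reflexive (length-++ (f x))) (+-mono-≤ (≤t x) (length-concatMap-≤ f xs ≤t))

-- `xs` lies inside the concatenation of its fibres over `cs`, each of length at most `t`. This
-- serves twice: for colours covering the positions of one class, and for colours covering the
-- classes in which some colour is heavy.
pigeonhole : {P : C → A → Set} (P? : ∀ c → Decidable (P c)) {t : ℕ} (cs : List C) {xs : List A} →
             Unique xs → (∀ {x} → x ∈ xs → ∃[ c ] c ∈ cs × P c x) →
             (∀ c → length (filter (P? c) xs) ≤ t) → length xs ≤ length cs * t
pigeonhole P? cs {xs} u cover ≤t =
  ≤-trans (length-mono-⊆ u λ x∈ → let c , c∈ , p = cover x∈ in
             ∈-concatMap⁺ (λ c → filter (P? c) xs) (Any.map (λ { refl → ∈-filter⁺ (P? c) x∈ p }) c∈))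
          (length-concatMap-≤ (λ c → filter (P? c) xs) cs ≤t)

injective-on-unique : {f : A → B} {xs : List A} → Unique (map f xs) →
                      ∀ {x y} → x ∈ xs → y ∈ xs → f x ≡ f y → x ≡ y
injective-on-unique u x∈ y∈ eq with ∈-AllPairs₂ (AllPairs.map⁻ u) x∈ y∈
... | inj₁ x≡y        = x≡y
... | inj₂ (inj₁ neq) = contradiction eq neq
... | inj₂ (inj₂ neq) = contradiction (sym eq) neq

filter-map : {P : Pred B 0ℓ} (P? : Decidable P) (f : A → B) (xs : List A) →
             filter P? (map f xs) ≡ map f (filter (P? ∘ f) xs)
filter-map P? f []       = refl
filter-map P? f (x ∷ xs) with does (P? (f x))
... | true  = cong (f x ∷_) (filter-map P? f xs)
... | false = filter-map P? f xs

length-filter-split : {P : Pred A 0ℓ} (P? : Decidable P) (xs : List A) →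
                      length xs ≤ length (filter P? xs) + length (filter (∁? P?) xs)
length-filter-split P? []       = z≤n
length-filter-split P? (x ∷ xs) with does (P? x)
... | true  = s≤s (length-filter-split P? xs)
... | false = ≤-trans (s≤s (length-filter-split P? xs)) (≤-reflexive (sym (+-suc _ _)))

_∉?_ : ∀ {m} (x : Fin m) (xs : List (Fin m)) → Dec (x ∉ xs)
x ∉? xs = ¬? (x ∈? xs)

complement-↭ : ∀ {m} {xs ys : List (Fin m)} → Unique xs → Unique ys → xs ⊆ ys →
               xs ++ filter (_∉? xs) ys ↭ ys
complement-↭ {xs = xs} {ys} uxs uys xs⊆ys = unique-↭
  (Unique.++⁺ uxs (filter⁺ (_∉? xs) uys) λ (∈xs , ∈c) → proj₂ (∈-filter⁻ (_∉? xs) {xs = ys} ∈c) ∈xs)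
  uys to from
  where
  to : xs ++ filter (_∉? xs) ys ⊆ ys
  to z∈ with ∈-++⁻ xs z∈
  ... | inj₁ z∈xs = xs⊆ys z∈xs
  ... | inj₂ z∈c  = proj₁ (∈-filter⁻ (_∉? xs) z∈c)

  from : ys ⊆ xs ++ filter (_∉? xs) ys
  from {z} z∈ with z ∈? xs
  ... | yes z∈xs = ∈-++⁺ˡ z∈xs
  ... | no  z∉xs = ∈-++⁺ʳ xs (∈-filter⁺ (_∉? xs) z∈ z∉xs)

-- The rainbow edge gives the parts three roles: `a` is a single vertex, `b` goes to the class
-- filled last, and `ys` is served greedily.
split-member : {a : A} {xs : List A} → a ∈ xs → 2 ≤ length xs → ∃[ b ] ∃[ ys ] a ∷ b ∷ ys ↭ xs
split-member {a = a} a∈ 2≤ with ∈-∃++ a∈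
... | ys , zs , refl with ys ++ zs | ↭.shift a ys zs
...   | b ∷ rest | ↭a = b , rest , ↭-sym ↭a
...   | []       | ↭a with subst (2 ≤_) (↭.↭-length ↭a) 2≤
...     | s≤s ()

map-unique-local : {f : A → B} {xs : List A} → (∀ {x y} → x ∈ xs → y ∈ xs → f x ≡ f y → x ≡ y) →
                   Unique xs → Unique (map f xs)
map-unique-local inj []        = []
map-unique-local inj (x∉ ∷ u) =
  All.map⁺ (All.tabulate λ y∈ eq → All.lookup x∉ y∈ (inj (here refl) (there y∈) eq))
  ∷ map-unique-local (λ x∈ y∈ → inj (there x∈) (there y∈)) u

length≤codomain : ∀ {t} {f : A → Fin t} {xs} → (∀ {x y} → x ∈ xs → y ∈ xs → f x ≡ f y → x ≡ y) →
                  Unique xs → length xs ≤ t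
length≤codomain {t = t} {f} {xs} inj u = subst₂ _≤_ (length-map f xs) (length-tabulate {n = t} id)
  (length-mono-⊆ (map-unique-local inj u) λ _ → ∈-allFin _)

remQuot-injective : ∀ {m k} {x y : Fin (m * k)} →
                    quotient {m} k x ≡ quotient k y → remainder {m} k x ≡ remainder {m} k y → x ≡ y
remQuot-injective {m} {k} {x} {y} q≡ r≡ =
  trans (sym (Fin.combine-remQuot {m} k x)) (trans (cong₂ combine q≡ r≡) (Fin.combine-remQuot {m} k y))

-- The remainder of `m + d′` modulo `d` is at most `d′`, so cancelling `d′` leaves the bound.
m≤⌈m/d⌉*d : ∀ m d .{{_ : NonZero d}} → m ≤ ⌈ m / d ⌉ * d
m≤⌈m/d⌉*d m d@(suc d′) = +-cancelʳ-≤ d′ m _ (begin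
  m + d′                                  ≡⟨ m≡m%n+[m/n]*n (m + d′) d ⟩
  (m + d′) % d + ⌈ m / d ⌉ * d            ≤⟨ +-monoˡ-≤ _ (s≤s⁻¹ (m%n<n (m + d′) d)) ⟩
  d′ + ⌈ m / d ⌉ * d                      ≡⟨ +-comm d′ _ ⟩
  ⌈ m / d ⌉ * d + d′                      ∎)
  where open ≤-Reasoning

⌈m/d⌉≤m : ∀ m d .{{_ : NonZero m}} .{{_ : NonZero d}} → ⌈ m / d ⌉ ≤ m
⌈m/d⌉≤m m d@(suc d′) = begin
  (m + d′) / d     ≤⟨ /-monoˡ-≤ d (+-monoʳ-≤ m (m≤n*m d′ m)) ⟩
  (m + m * d′) / d ≡⟨ cong (_/ d) (*-suc m d′) ⟨
  (m * d) / d      ≡⟨ m*n/n≡m m d ⟩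
  m                ∎
  where open ≤-Reasoning

-- Subsets as duplicate-free lists, and cardinalities.

elements : ∀ {m} → Subset m → List (Fin m)
elements Vec.[]            = []
elements (true  Vec.∷ S) = zero ∷ map suc (elements S)
elements (false Vec.∷ S) = map suc (elements S)

length-elements : ∀ {m} (S : Subset m) → length (elements S) ≡ ∣ S ∣
length-elements Vec.[]            = refl
length-elements (true  Vec.∷ S) = cong suc (trans (length-map suc (elements S)) (length-elements S))
length-elements (false Vec.∷ S) = trans (length-map suc (elements S)) (length-elements S)

zero∉map-suc : ∀ {m} {xs : List (Fin m)} → zero ∉ map suc xs
zero∉map-suc z∈ with ∈-map⁻ suc z∈
... | _ , _ , ()

elements-unique : ∀ {m} (S : Subset m) → Unique (elements S)
elements-unique Vec.[]            = []
elements-unique (true  Vec.∷ S) =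
  All.tabulate (λ { x∈ refl → zero∉map-suc x∈ }) ∷ Unique.map⁺ Fin.suc-injective (elements-unique S)
elements-unique (false Vec.∷ S) = Unique.map⁺ Fin.suc-injective (elements-unique S)

∈-elements⁺ : ∀ {m} {S : Subset m} {x} → x Subset.∈ S → x ∈ elements S
∈-elements⁺ {S = true  Vec.∷ S} here        = here refl
∈-elements⁺ {S = true  Vec.∷ S} (there x∈S) = there (∈-map⁺ suc (∈-elements⁺ x∈S))
∈-elements⁺ {S = false Vec.∷ S} (there x∈S) = ∈-map⁺ suc (∈-elements⁺ x∈S)

∈-elements⁻ : ∀ {m} {S : Subset m} {x} → x ∈ elements S → x Subset.∈ S
∈-elements⁻ {S = true  Vec.∷ S} (here refl) = here
∈-elements⁻ {S = true  Vec.∷ S} (there x∈) with ∈-map⁻ suc x∈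
... | _ , y∈ , refl = there (∈-elements⁻ y∈)
∈-elements⁻ {S = false Vec.∷ S} x∈ with ∈-map⁻ suc x∈
... | _ , y∈ , refl = there (∈-elements⁻ y∈)

∣∣≡length : ∀ {m} {S : Subset m} {xs} → Unique xs →
            (∀ {x} → x ∈ xs → x Subset.∈ S) → (∀ {x} → x Subset.∈ S → x ∈ xs) → ∣ S ∣ ≡ length xs
∣∣≡length {S = S} u xs⊆S S⊆xs = trans (sym (length-elements S))
  (↭.↭-length (unique-↭ (elements-unique S) u (S⊆xs ∘ ∈-elements⁻) (∈-elements⁺ ∘ xs⊆S)))

nonempty-of-nonZero : ∀ {m} {S : Subset m} → NonZero ∣ S ∣ → ∃[ x ] x Subset.∈ S
nonempty-of-nonZero {S = S} nz with elements S | length-elements S | ∈-elements⁻ {S = S}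
... | []    | ≡0 | _  = contradiction (sym ≡0) (≢-nonZero⁻¹ _ {{nz}})
... | x ∷ _ | _  | ∈S = x , ∈S (here refl)

two-elements : ∀ {m} {S : Subset m} → 2 ≤ ∣ S ∣ →
               ∃[ x ] ∃[ y ] x Subset.∈ S × y Subset.∈ S × x ≢ y
two-elements {S = S} 2≤ with elements S | length-elements S | elements-unique S | ∈-elements⁻ {S = S}
... | []        | eq | _             | _  = contradiction (subst (2 ≤_) (sym eq) 2≤) λ ()
... | _ ∷ []    | eq | _             | _  = contradiction (subst (2 ≤_) (sym eq) 2≤) λ { (s≤s ()) }
... | x ∷ y ∷ _ | _  | (x≢y ∷ _) ∷ _ | ∈S = x , y , ∈S (here refl) , ∈S (there (here refl)) , x≢y

module _ {m} {P : Fin m → Set} (P? : Decidable P) where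

  ∈-tabulate-does⁺ : ∀ {x} → P x → x Subset.∈ Vec.tabulate (does ∘ P?)
  ∈-tabulate-does⁺ {x} px = lookup⇒[]= x _ (trans (lookup∘tabulate (does ∘ P?) x) (dec-true (P? x) px))

  ∈-tabulate-does⁻ : ∀ {x} → x Subset.∈ Vec.tabulate (does ∘ P?) → P x
  ∈-tabulate-does⁻ {x} x∈ with P? x | trans (sym (lookup∘tabulate (does ∘ P?) x)) ([]=⇒lookup x∈)
  ... | yes px | _ = px
  ... | no _   | ()

-- Edges assembled from blocks.

module _ {n q : ℕ} where

  ∈V⁺ : ∀ {v i} → quotient q v ≡ i → v Subset.∈ V n q i
  ∈V⁺ {i = i} = ∈-tabulate-does⁺ (λ v → quotient q v Fin.≟ i)

  ∈V⁻ : ∀ {v i} → v Subset.∈ V n q i → quotient q v ≡ i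
  ∈V⁻ {i = i} = ∈-tabulate-does⁻ (λ v → quotient q v Fin.≟ i)

  quotient-combine : ∀ (i : Fin n) (j : Fin q) → quotient q (combine i j) ≡ i
  quotient-combine i j = cong proj₁ (Fin.remQuot-combine i j)

  -- A block (i , js) stands for the vertices of class i at the positions js.
  Block : Set
  Block = Fin n × List (Fin q)

  vertices : List Block → List (Fin (n * q))
  vertices = concatMap λ (i , js) → map (combine i) js

  ∈-vertices⁻ : ∀ bs {v} → v ∈ vertices bs →
                ∃[ i ] ∃[ js ] ∃[ j ] (i , js) ∈ bs × j ∈ js × v ≡ combine i j
  ∈-vertices⁻ ((i , js) ∷ bs) v∈ with ∈-++⁻ (map (combine i) js) v∈
  ... | inj₁ v∈js with ∈-map⁻ (combine i) v∈js
  ...   | j , j∈js , eq = i , js , j , here refl , j∈js , eq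
  ∈-vertices⁻ ((i , js) ∷ bs) v∈ | inj₂ v∈bs with ∈-vertices⁻ bs v∈bs
  ... | i′ , js′ , j , b∈ , rest = i′ , js′ , j , there b∈ , rest

  ∈-vertices⁺ : ∀ {bs i js j} → (i , js) ∈ bs → j ∈ js → combine i j ∈ vertices bs
  ∈-vertices⁺ b∈ j∈ = ∈-concatMap⁺ (λ (i , js) → map (combine i) js)
    (Any.map (λ { {k , _} refl → ∈-map⁺ (combine k) j∈ }) b∈)

  length-vertices : ∀ bs → length (vertices bs) ≡ sum (map (length ∘ proj₂) bs)
  length-vertices []              = refl
  length-vertices ((i , js) ∷ bs) = trans (length-++ (map (combine i) js))
    (cong₂ _+_ (length-map (combine i) js) (length-vertices bs))

  map-combine-unique : ∀ {i : Fin n} {js : List (Fin q)} → Unique js → Unique (map (combine i) js)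
  map-combine-unique {i} = Unique.map⁺ λ {j} {k} → Fin.combine-injectiveʳ i j i k

  vertices-unique : ∀ {bs} → Unique (map proj₁ bs) → All (Unique ∘ proj₂) bs → Unique (vertices bs)
  vertices-unique []         []       = []
  vertices-unique {(i , js) ∷ bs} (i∉ ∷ u) (ujs ∷ us) =
    Unique.++⁺ (map-combine-unique ujs) (vertices-unique u us) disjoint
    where
    disjoint : ∀ {v} → ¬ (v ∈ map (combine i) js × v ∈ vertices bs)
    disjoint (v∈js , v∈bs) with ∈-map⁻ (combine i) v∈js | ∈-vertices⁻ bs v∈bs
    ... | j , _ , refl | i′ , _ , j′ , b∈ , _ , eq =
      All.lookup i∉ (∈-map⁺ proj₁ b∈) (Fin.combine-injectiveˡ i j i′ j′ eq)

  module _ {r} {σ : Partition r} {bs : List Block}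
           (u : Unique (map proj₁ bs)) (us : All (Unique ∘ proj₂) bs)
           (sizes : map (length ∘ proj₂) bs ↭ parts σ) where

    private
      R : Subset (n * q)
      R = Vec.tabulate λ v → does (v ∈? vertices bs)

      size : Fin n → ℕ
      size i = ∣ R ∩ V n q i ∣

    ∈⇒∈-vertices : ∀ {v} → v Subset.∈ R → v ∈ vertices bs
    ∈⇒∈-vertices = ∈-tabulate-does⁻ (_∈? vertices bs)

    ∈-vertices⇒∈ : ∀ {v} → v ∈ vertices bs → v Subset.∈ R
    ∈-vertices⇒∈ = ∈-tabulate-does⁺ (_∈? vertices bs)

    -- No other block contributes to class `i`, because the blocks lie in pairwise distinct classes.
    size-block : ∀ {i js} → (i , js) ∈ bs → size i ≡ length js
    size-block {i} {js} b∈ =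
      trans (∣∣≡length (map-combine-unique (All.lookup us b∈)) to from) (length-map (combine i) js)
      where
      to : ∀ {v} → v ∈ map (combine i) js → v Subset.∈ R ∩ V n q i
      to v∈ with ∈-map⁻ (combine i) v∈
      ... | j , j∈ , refl = x∈p∩q⁺ (∈-vertices⇒∈ (∈-vertices⁺ b∈ j∈) , ∈V⁺ (quotient-combine i j))

      from : ∀ {v} → v Subset.∈ R ∩ V n q i → v ∈ map (combine i) js
      from v∈ with x∈p∩q⁻ R (V n q i) v∈
      ... | v∈R , v∈V with ∈-vertices⁻ bs (∈⇒∈-vertices v∈R)
      ...   | i′ , js′ , j , b′∈ , j∈ , refl
              with injective-on-unique u b∈ b′∈ (trans (sym (∈V⁻ v∈V)) (quotient-combine i′ j))
      ...     | refl = ∈-map⁺ (combine i) j∈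

    size-nonZero⇒∈ : ∀ {i} → NonZero (size i) → i ∈ map proj₁ bs
    size-nonZero⇒∈ {i} nz with nonempty-of-nonZero nz
    ... | v , v∈ with x∈p∩q⁻ R (V n q i) v∈
    ...   | v∈R , v∈V with ∈-vertices⁻ bs (∈⇒∈-vertices v∈R)
    ...     | i′ , js′ , j , b∈ , _ , refl =
      subst (_∈ map proj₁ bs) (trans (sym (quotient-combine i′ j)) (∈V⁻ v∈V)) (∈-map⁺ proj₁ b∈)

    -- The length of a block is a part of `σ`, and parts are positive.
    ∈⇒size-nonZero : ∀ {i} → i ∈ map proj₁ bs → NonZero (size i)
    ∈⇒size-nonZero i∈ with ∈-map⁻ proj₁ i∈
    ... | (i , js) , b∈ , refl = subst NonZero (sym (size-block b∈))
      (All.lookup (↭.All-resp-↭ (↭-sym sizes) (positive σ)) (∈-map⁺ (length ∘ proj₂) b∈))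

    blocks-edge : Edge (ℋ n r q σ) R
    blocks-edge = card , sizes′
      where
      card : ∣ R ∣ ≡ r
      card = begin
        ∣ R ∣                         ≡⟨ ∣∣≡length (vertices-unique u us) ∈-vertices⇒∈ ∈⇒∈-vertices ⟩
        length (vertices bs)          ≡⟨ length-vertices bs ⟩
        sum (map (length ∘ proj₂) bs) ≡⟨ sum-↭ sizes ⟩
        sum (parts σ)                 ≡⟨ total σ ⟩
        r                             ∎
        where open ≡-Reasoning

      occupied : filter (nonZero? ∘ size) (allFin n) ↭ map proj₁ bs
      occupied = unique-↭ (filter⁺ (nonZero? ∘ size) (allFin⁺ n)) u
        (size-nonZero⇒∈ ∘ proj₂ ∘ ∈-filter⁻ (nonZero? ∘ size) {xs = allFin n})
        (λ i∈ → ∈-filter⁺ (nonZero? ∘ size) (∈-allFin _) (∈⇒size-nonZero i∈))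

      sizes′ : filter nonZero? (intersectionSizes n q R) ↭ parts σ
      sizes′ = begin
        filter nonZero? (map size (allFin n))          ≡⟨ filter-map nonZero? size (allFin n) ⟩
        map size (filter (nonZero? ∘ size) (allFin n)) ↭⟨ ↭.map⁺ size occupied ⟩
        map size (map proj₁ bs)                        ≡⟨ map-∘ bs ⟨
        map (size ∘ proj₁) bs                          ≡⟨ map-cong-local (All.tabulate size-block) ⟩
        map (length ∘ proj₂) bs                        ↭⟨ sizes ⟩
        parts σ                                        ∎
        where open PermutationReasoning

    edge-of-blocks : ∃[ S ] Edge (ℋ n r q σ) S × (∀ {v} → v Subset.∈ S → v ∈ vertices bs)
    edge-of-blocks = R , blocks-edge , ∈⇒∈-vertices

  -- The first index lists the classes allowed, not those used, so adding a block only requires its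
  -- class to be outside that list. Sizes follow the exact order of the second index, to match
  -- recursion on the parts; a permutation enters only when an edge is formed.
  record BlockSystem (is : List (Fin n)) (ps : List ℕ) : Set where
    field
      blocks  : List Block
      within  : map proj₁ blocks ⊆ is
      classes : Unique (map proj₁ blocks)
      members : All (Unique ∘ proj₂) blocks
      sizes   : map (length ∘ proj₂) blocks ≡ ps

    points : List (Fin (n * q))
    points = vertices blocks

  open BlockSystem

  noBlocks : ∀ {is} → BlockSystem is []
  noBlocks = record { blocks = [] ; within = λ () ; classes = [] ; members = [] ; sizes = refl }

  addBlock : ∀ {i is js p ps} → i ∉ is → Unique js → length js ≡ p →
             BlockSystem is ps → BlockSystem (i ∷ is) (p ∷ ps)
  addBlock {i} {js = js} i∉is ujs eq B = record
    { blocks  = (i , js) ∷ blocks B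
    ; within  = λ { (here refl) → here refl ; (there k∈) → there (within B k∈) }
    ; classes = All.tabulate (λ { k∈ refl → i∉is (within B k∈) }) ∷ classes B
    ; members = ujs ∷ members B
    ; sizes   = cong₂ _∷_ eq (sizes B)
    }

  edge-of-system : ∀ {r} {σ : Partition r} {is ps} (B : BlockSystem is ps) → ps ↭ parts σ →
                   ∃[ R ] Edge (ℋ n r q σ) R × (∀ {v} → v Subset.∈ R → v ∈ points B)
  edge-of-system {σ = σ} B ps↭ =
    edge-of-blocks {σ = σ} (classes B) (members B) (↭-trans (↭-reflexive (sizes B)) ps↭)

  -- Heavy colours and monochromatic edges.

  module _ {k : ℕ} (col : Fin (n * q) → Fin k) where

    Has : Fin n → Fin k → Set
    Has i e = ∃[ j ] col (combine i j) ≡ e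

    has? : ∀ i → Decidable (Has i)
    has? i e = Fin.any? λ j → col (combine i j) Fin.≟ e

    colourClass : Fin n → Fin k → List (Fin q)
    colourClass i e = filter (λ j → col (combine i j) Fin.≟ e) (allFin q)

    colourClass-unique : ∀ i e → Unique (colourClass i e)
    colourClass-unique i e = filter⁺ _ (allFin⁺ q)

    colourClass-colour : ∀ {i e j} → j ∈ colourClass i e → col (combine i j) ≡ e
    colourClass-colour {i} {e} = proj₂ ∘ ∈-filter⁻ (λ j → col (combine i j) Fin.≟ e) {xs = allFin q}

    heavy? : ∀ D e → Decidable (λ i → D ≤ length (colourClass i e))
    heavy? D e i = D ≤? length (colourClass i e)

    -- The next part `p` is at most `D`, so the next class has enough positions of colour `e` to
    -- supply it.
    monochromatic-system : ∀ {D e} is ps → Unique is → All (λ i → D ≤ length (colourClass i e)) is →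
                           All (_≤ D) ps → length ps ≤ length is →
                           Σ[ B ∈ BlockSystem is ps ] (∀ {v} → v ∈ points B → col v ≡ e)
    monochromatic-system is [] _ _ _ _ = noBlocks , λ ()
    monochromatic-system {e = e} (i ∷ is) (p ∷ ps) (i∉ ∷ u) (h ∷ hs) (p≤D ∷ ps≤D) (s≤s len)
      with monochromatic-system is ps u hs ps≤D len
    ... | B , B-mono = addBlock {js = js} (λ i∈ → All.lookup i∉ i∈ refl) (Unique.take⁺ p (colourClass-unique i e))
                         (trans (length-take p (colourClass i e)) (m≤n⇒m⊓n≡m (≤-trans p≤D h))) B , mono
      where
      js = take p (colourClass i e)
      mono : ∀ {v} → v ∈ map (combine i) js ++ points B → col v ≡ e
      mono v∈ with ∈-++⁻ (map (combine i) js) v∈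
      ... | inj₂ v∈B = B-mono v∈B
      ... | inj₁ v∈js with ∈-map⁻ (combine i) v∈js
      ...   | j , j∈ , refl = colourClass-colour (All.lookup (All.take⁺ p (All.tabulate id)) j∈)

    -- If `s σ` classes each held `Δ σ` vertices of colour `e`, every part of `σ` would fit into its
    -- own class in colour `e`, giving a monochromatic edge.
    few-heavy-classes : ∀ {r} {σ : Partition r} → (∀ R → Edge (ℋ n r q σ) R → ¬ Monochromatic col R) →
                        ∀ e → length (filter (heavy? (Δ σ) e) (allFin n)) < s σ
    few-heavy-classes {σ = σ} ¬mono e = ≰⇒> λ s≤ →
      let B , mono = monochromatic-system _ (parts σ) (filter⁺ _ (allFin⁺ n))
                       (all-filter (heavy? (Δ σ) e) (allFin n)) (xs≤max 0 (parts σ)) s≤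
          R , edge , R⊆ = edge-of-system {σ = σ} B ↭-refl
      in ¬mono R edge λ u v u∈ v∈ → trans (mono (R⊆ u∈)) (sym (mono (R⊆ v∈)))

    -- Almost full classes and rainbow edges.

    AlmostFull : Fin n → Set
    AlmostFull i = ∀ {e e′} → ¬ Has i e → ¬ Has i e′ → e ≡ e′

    -- Keeping the order of `T` lets one equation yield both the length of `js` and, when `T` has no
    -- repetition, its distinctness.
    choose : ∀ {i T} → All (Has i) T → ∃[ js ] map col (map (combine i) js) ≡ T
    choose [] = [] , refl
    choose ((j , eq) ∷ hs) with choose hs
    ... | js , eqs = j ∷ js , cong₂ _∷_ eq eqs

    chosen-unique : ∀ {i : Fin n} {js : List (Fin q)} {T} → map col (map (combine i) js) ≡ T → Unique T → Unique js
    chosen-unique refl u = Unique.map⁻ (Unique.map⁻ u)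

    length-chosen : ∀ {i : Fin n} {js : List (Fin q)} {T} → map col (map (combine i) js) ≡ T → length js ≡ length T
    length-chosen {i} {js} refl = sym (trans (length-map col (map (combine i) js)) (length-map (combine i) js))

    -- Any two missing colours agree, so a duplicate-free list loses at most one entry under
    -- `filter (has? i)`.
    few-missing : ∀ {i S} → AlmostFull i → Unique S → length S ≤ suc (length (filter (has? i) S))
    few-missing {i} {S} af u = ≤-trans (length-filter-split (has? i) S)
      (≤-trans (+-monoʳ-≤ _ missing≤1) (≤-reflexive (+-comm _ 1)))
      where
      missing≤1 : length (filter (∁? (has? i)) S) ≤ 1
      missing≤1 with filter (∁? (has? i)) S | all-filter (∁? (has? i)) S | filter⁺ (∁? (has? i)) u
      ... | []        | _            | _               = z≤n
      ... | _ ∷ []    | _            | _               = s≤s z≤n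
      ... | _ ∷ _ ∷ _ | ¬p ∷ ¬q ∷ _ | (x≢y ∷ _) ∷ _ = contradiction (af ¬p ¬q) x≢y

    -- Since a ≥ 1 colours stay in reserve, the one colour that the current class may miss does no harm.
    rainbow-system : ∀ {a} is ps {S} → 1 ≤ a → Unique is → All AlmostFull is → length ps ≤ length is →
                     Unique S → length S ≡ a + sum ps →
                     Σ[ B ∈ BlockSystem is ps ] ∃[ S′ ]
                       Unique S′ × length S′ ≡ a × map col (points B) ++ S′ ↭ S
    rainbow-system {a} is [] {S} _ _ _ _ uS eq = noBlocks , S , uS , trans eq (+-identityʳ a) , ↭-refl
    rainbow-system {a} (i ∷ is) (p ∷ ps) {S} 1≤a (i∉ ∷ u) (af ∷ afs) (s≤s len) uS eq =
      let js , eqT = choose T-has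
          B , S′ , uS′ , eqS′ , B↭ = rainbow-system is ps 1≤a u afs len (filter⁺ _ uS) length-rest
      in addBlock {js = js} (λ i∈ → All.lookup i∉ i∈ refl)
           (chosen-unique {i} eqT uT) (trans (length-chosen {i} eqT) length-T) B
         , S′ , uS′ , eqS′ ,
         (begin
           map col (map (combine i) js ++ points B) ++ S′       ≡⟨ cong (_++ S′) (map-++ col (map (combine i) js) (points B)) ⟩
           (map col (map (combine i) js) ++ map col (points B)) ++ S′ ≡⟨ ++-assoc (map col (map (combine i) js)) _ S′ ⟩
           map col (map (combine i) js) ++ map col (points B) ++ S′ ≡⟨ cong (_++ map col (points B) ++ S′) eqT ⟩
           T ++ map col (points B) ++ S′                        ↭⟨ ↭.++⁺ˡ T B↭ ⟩
           T ++ rest                                            ↭⟨ T++rest ⟩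
           S                                                    ∎)
      where
      open PermutationReasoning
      F = filter (has? i) S
      T = take p F
      rest = filter (_∉? T) S

      T-has : All (Has i) T
      T-has = All.take⁺ p (all-filter (has? i) S)

      uT : Unique T
      uT = Unique.take⁺ p (filter⁺ (has? i) uS)

      p≤ : p ≤ length F
      p≤ = s≤s⁻¹ (≤-trans (≤-trans (+-mono-≤ 1≤a (m≤m+n p (sum ps))) (≤-reflexive (sym eq))) (few-missing af uS))

      length-T : length T ≡ p
      length-T = trans (length-take p F) (m≤n⇒m⊓n≡m p≤)

      T++rest : T ++ rest ↭ S
      T++rest = complement-↭ uT uS
        (proj₁ ∘ ∈-filter⁻ (has? i) {xs = S} ∘ All.lookup (All.take⁺ p (All.tabulate id)))

      length-rest : length rest ≡ a + sum ps
      length-rest = +-cancelˡ-≡ p _ _ (Eq.begin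
        p + length rest        Eq.≡⟨ cong (_+ length rest) length-T ⟨
        length T + length rest Eq.≡⟨ length-++ T ⟨
        length (T ++ rest)     Eq.≡⟨ ↭.↭-length T++rest ⟩
        length S               Eq.≡⟨ eq ⟩
        a + (p + sum ps)       Eq.≡⟨ x∙yz≈y∙xz +-commutativeSemigroup a p (sum ps) ⟩
        p + (a + sum ps)       Eq.∎)
        where module Eq = ≡-Reasoning

    Pivot : Fin n → Set
    Pivot A = ∃[ v ] quotient q v ≢ A × (∀ {e} → e ≢ col v → Has A e)

    -- If `A` has every colour, any vertex of the second class `B` will do. Otherwise a missing
    -- colour occurs somewhere by surjectivity, necessarily outside `A`, and almost fullness makes
    -- it the only one missing.
    pivot : Surjective _≡_ _≡_ col → ∀ {A B} → AlmostFull A → A ≢ B → Fin q → Pivot A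
    pivot surj {A} {B} af A≢B j₀ with Fin.all? (has? A)
    ... | yes full = combine B j₀ , (λ eq → A≢B (trans (sym eq) (quotient-combine B j₀))) , λ _ → full _
    ... | no ¬full with Fin.¬∀⟶∃¬ k (Has A) (has? A) ¬full
    ...   | e , ¬has with surj e
    ...     | v , col-v = v , v∉A , others
          where
          v∉A : quotient q v ≢ A
          v∉A refl = ¬has (remainder {n} q v , trans (cong col (Fin.combine-remQuot {n} q v)) (col-v refl))

          others : ∀ {e′} → e′ ≢ col v → Has A e′
          others {e′} e′≢ with has? A e′
          ... | yes h = h
          ... | no ¬h = contradiction (trans (af ¬h ¬has) (sym (col-v refl))) e′≢

    -- `σ` partitions the number `k` of colours, so a rainbow edge uses each colour exactly once.
    -- The vertex `v` brings its own colour, the classes in `others` take the parts `ps` greedily,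
    -- and `A` receives the `a` colours that remain.
    rainbow-edge : ∀ {σ : Partition k} → 1 ∈ parts σ → 2 ≤ s σ → Surjective _≡_ _≡_ col → Fin q →
                   ∀ {is} → Unique is → All AlmostFull is → s σ ≤ length is →
                   ∃[ R ] Edge (ℋ n k q σ) R × Rainbow col R
    rainbow-edge _ 2≤s _ _ {[]}     _ _ s≤ = contradiction (≤-trans 2≤s s≤) λ ()
    rainbow-edge _ 2≤s _ _ {_ ∷ []} _ _ s≤ = contradiction (≤-trans 2≤s s≤) λ { (s≤s ()) }
    rainbow-edge {σ} 1∈ 2≤s surj j₀ {A ∷ is@(D₀ ∷ _)} (A∉ ∷ uG) (af ∷ afs) s≤
      with split-member 1∈ 2≤s | pivot surj af (All.lookup A∉ (here refl)) j₀
    ... | a , ps , ↭σ | v , D≢A , A-has = R , edge , λ x y x∈ y∈ → injective-on-unique rainbow (R⊆ x∈) (R⊆ y∈)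
      where
      c = col v
      D = quotient q v
      j = remainder {n} q v

      -- The class `D` of `v` may occur in `is` and must not receive a second block.
      others = filter (_∉? (D ∷ [])) is
      colours = filter (_∉? (c ∷ [])) (allFin k)

      A∉others : A ∉ others
      A∉others A∈ = All.lookup A∉ (proj₁ (∈-filter⁻ (_∉? (D ∷ [])) A∈)) refl

      D∉ : D ∉ A ∷ others
      D∉ (here D≡A)  = D≢A D≡A
      D∉ (there D∈) = proj₂ (∈-filter⁻ (_∉? (D ∷ [])) {xs = is} D∈) (here refl)

      is⊆ : is ⊆ D ∷ others
      is⊆ {i} i∈ with i ∈? (D ∷ [])
      ... | yes (here i≡D) = here i≡D
      ... | no i∉          = there (∈-filter⁺ (_∉? (D ∷ [])) i∈ i∉)

      -- Removing `D` costs at most one class: `is` has at least `s σ ∸ 1` members, so at least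
      -- `s σ ∸ 2`, the length of `ps`, remain.
      enough : length ps ≤ length others
      enough = s≤s⁻¹ (s≤s⁻¹ (≤-trans (≤-reflexive (↭.↭-length ↭σ))
                 (≤-trans s≤ (s≤s (length-mono-⊆ uG is⊆)))))

      colours↭ : c ∷ colours ↭ allFin k
      colours↭ = complement-↭ {xs = c ∷ []} ([] ∷ []) (allFin⁺ k) λ { (here refl) → ∈-allFin c }

      -- One colour and the part `1` are spent on `v`; the other colours match `a` and `ps` exactly.
      length-colours : length colours ≡ a + sum ps
      length-colours = suc-injective (begin
        length (c ∷ colours)  ≡⟨ ↭.↭-length colours↭ ⟩
        length (allFin k)     ≡⟨ length-tabulate {n = k} id ⟩
        k                     ≡⟨ total σ ⟨
        sum (parts σ)         ≡⟨ sum-↭ ↭σ ⟨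
        suc (a + sum ps)      ∎)
        where open ≡-Reasoning

      1≤a : 1 ≤ a
      1≤a = >-nonZero⁻¹ a {{All.lookup (↭.All-resp-↭ (↭-sym ↭σ) (positive σ)) (there (here refl))}}

      greedy = rainbow-system others ps 1≤a (filter⁺ (_∉? (D ∷ [])) uG)
        (All.tabulate λ i∈ → All.lookup afs (proj₁ (∈-filter⁻ (_∉? (D ∷ [])) i∈)))
        enough (filter⁺ _ (allFin⁺ k)) length-colours

      G : BlockSystem others ps
      G = proj₁ greedy

      left : List (Fin k)
      left = proj₁ (proj₂ greedy)

      uleft = proj₁ (proj₂ (proj₂ greedy))
      length-left = proj₁ (proj₂ (proj₂ (proj₂ greedy)))
      G↭ = proj₂ (proj₂ (proj₂ (proj₂ greedy)))

      -- `left` comes from `colours`, which excludes `c`, the only colour that `A` can lack.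
      left-has : All (Has A) left
      left-has = All.tabulate λ {e} e∈ → A-has λ e≡c →
        proj₂ (∈-filter⁻ (_∉? (c ∷ [])) {xs = allFin k}
          (↭.∈-resp-↭ G↭ (∈-++⁺ʳ (map col (points G)) e∈))) (here e≡c)

      js = proj₁ (choose left-has)
      js-left = proj₂ (choose left-has)

      S : BlockSystem (D ∷ A ∷ others) (1 ∷ a ∷ ps)
      S = addBlock {js = j ∷ []} D∉ ([] ∷ []) refl
            (addBlock A∉others (chosen-unique {A} js-left uleft) (trans (length-chosen {A} js-left) length-left) G)

      -- The colours of the chosen points are a rearrangement of all `k` colours, so no two
      -- coincide.
      S↭ : map col (points S) ↭ allFin k
      S↭ = begin
        col (combine D j) ∷ map col (map (combine A) js ++ points G)
          ≡⟨ cong₂ _∷_ (cong col (Fin.combine-remQuot {n} q v)) (map-++ col (map (combine A) js) (points G)) ⟩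
        c ∷ map col (map (combine A) js) ++ map col (points G)
          ≡⟨ cong (λ T → c ∷ T ++ map col (points G)) js-left ⟩
        c ∷ left ++ map col (points G)
          ↭⟨ ↭-prep c (↭-trans (↭.++-comm left _) G↭) ⟩
        c ∷ colours
          ↭⟨ colours↭ ⟩
        allFin k ∎
        where open PermutationReasoning

      rainbow : Unique (map col (points S))
      rainbow = Unique-resp-↭ (↭-sym S↭) (allFin⁺ k)

      built = edge-of-system {σ = σ} S ↭σ
      R = proj₁ built
      edge = proj₁ (proj₂ built)
      R⊆ = proj₂ (proj₂ built)

    -- Counting heavy and light classes.

    heavy-or-light : ∀ t i → (∃[ e ] t < length (colourClass i e)) ⊎ (∀ e → length (colourClass i e) ≤ t)
    heavy-or-light t i with Fin.any? (λ e → heavy? (suc t) e i)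
    ... | yes heavy = inj₁ heavy
    ... | no ¬heavy = inj₂ λ e → ≮⇒≥ λ t< → ¬heavy (e , t<)

    -- Each position of class `i` carries a colour from `es`, and each colour accounts for at most
    -- `t` positions.
    light-bound : ∀ {t i} → (∀ e → length (colourClass i e) ≤ t) →
                  (es : List (Fin k)) → (∀ j → col (combine i j) ∈ es) → q ≤ length es * t
    light-bound {i = i} light es cover = subst (_≤ _) (length-tabulate {n = q} id)
      (pigeonhole (λ e j → col (combine i j) Fin.≟ e) es (allFin⁺ q)
        (λ {j} _ → col (combine i j) , cover j , refl) light)

    -- Sorting the classes in `xs` by their heavy colours puts at most `u` of them under each of the
    -- `k` colours.
    heavy-count : ∀ {D u xs} → Unique xs → (∀ {i} → i ∈ xs → ∃[ e ] D ≤ length (colourClass i e)) →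
                  (∀ e → length (filter (heavy? D e) (allFin n)) ≤ u) → length xs ≤ k * u
    heavy-count {D} {u} {xs} uxs heavy bound = subst (λ m → length xs ≤ m * u) (length-tabulate {n = k} id)
      (pigeonhole (heavy? D) (allFin k) uxs (λ i∈ → let e , h = heavy i∈ in e , ∈-allFin e , h)
        (λ e → ≤-trans (length-mono-⊆ (filter⁺ (heavy? D e) uxs) λ i∈ →
                         ∈-filter⁺ (heavy? D e) (∈-allFin _) (proj₂ (∈-filter⁻ (heavy? D e) {xs = xs} i∈)))
                       (bound e)))

    -- Two distinct missing colours would leave at most `k ∸ 2` colours, each on at most `t`
    -- positions: too few for the `(k ∸ 1) * t` positions of the class.
    light⇒almostFull : ∀ {t i} → 0 < t → q ≡ (k ∸ 1) * t →
                       (∀ e → length (colourClass i e) ≤ t) → AlmostFull i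
    light⇒almostFull {t} {i} 0<t q≡ light {e} {e′} ¬e ¬e′ with e Fin.≟ e′
    ... | yes e≡e′ = e≡e′
    ... | no  e≢e′ = contradiction q<q (<-irrefl refl)
      where
      missed = e ∷ e′ ∷ []
      present = filter (_∉? missed) (allFin k)

      cover : ∀ j → col (combine i j) ∈ present
      cover j = ∈-filter⁺ (_∉? missed) (∈-allFin _) λ
        { (here eq) → ¬e (j , eq) ; (there (here eq)) → ¬e′ (j , eq) }

      missed+present : suc (suc (length present)) ≤ k
      missed+present = ≤-reflexive (trans
        (↭.↭-length (complement-↭ {xs = missed} ((e≢e′ ∷ []) ∷ [] ∷ []) (allFin⁺ k) λ _ → ∈-allFin _))
        (length-tabulate {n = k} id))

      q<q : q < q
      q<q = begin-strict
        q                      ≤⟨ light-bound light present cover ⟩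
        length present * t     <⟨ m<n+m _ 0<t ⟩
        -- The inequality `k ≤ 1 + (k ∸ 1)` holds for every `k`, which avoids a case distinction.
        suc (length present) * t ≤⟨ *-monoˡ-≤ t (s≤s⁻¹ (≤-trans missed+present (m≤n+m∸n k 1))) ⟩
        (k ∸ 1) * t            ≡⟨ q≡ ⟨
        q                      ∎
        where open ≤-Reasoning

-- Impossibility with at most `r ∸ 2` colours and with `r` colours.

module _ {n r t : ℕ} {σ : Partition r} (Δ≡ : Δ σ ≡ suc t) where

  -- A class without heavy colour has at most `k * t` vertices, fewer than `(r ∸ 1) * t`. So every
  -- class has a heavy colour, and as each colour is heavy in at most `s σ ∸ 1` classes, `n` would
  -- be at most `k * (s σ ∸ 1)`.
  not-colourable-below : ∀ {k} → k < r ∸ 1 → 0 < t → k * (s σ ∸ 1) < n →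
                         ¬ NMNRColourable k (ℋ n r ((r ∸ 1) * t) σ)
  not-colourable-below {k} k< 0<t n> (col , nmnr) = <-irrefl refl (<-≤-trans n>
    (subst (_≤ k * (s σ ∸ 1)) (length-tabulate {n = n} id)
      (heavy-count {n} col (allFin⁺ n) (λ {i} _ → heavy i)
        (λ e → <⇒≤pred (few-heavy-classes {n} col {σ = σ} (IsNMNR.nonMonochromatic nmnr) e)))))
    where
    heavy : ∀ i → ∃[ e ] Δ σ ≤ length (colourClass {n} col i e)
    heavy i with heavy-or-light {n} col t i
    ... | inj₁ (e , h) = e , ≤-trans (≤-reflexive Δ≡) h
    ... | inj₂ light = contradiction
      (light-bound {n} col light (allFin k) (λ j → ∈-allFin _))
      (<⇒≱ (subst (λ m → m * t < (r ∸ 1) * t) (sym (length-tabulate {n = k} id)) (*-monoˡ-< t {{>-nonZero 0<t}} k<)))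

  -- At most `r * (s σ ∸ 1)` classes have a heavy colour, so at least `s σ` have none. With `r`
  -- colours these are almost full, which suffices for a rainbow edge.
  not-colourable-at : 0 < t → 0 < r ∸ 1 → 1 ∈ parts σ → 2 ≤ s σ → r * (s σ ∸ 1) + s σ ≤ n →
                      ¬ NMNRColourable r (ℋ n r ((r ∸ 1) * t) σ)
  not-colourable-at 0<t 0<r 1∈ 2≤s n≥ (col , nmnr) =
    nonRainbow (proj₁ edge) (proj₁ (proj₂ edge)) (proj₂ (proj₂ edge))
    where
    open IsNMNR nmnr
    heavies = λ i → Fin.any? λ e → heavy? {n} col (Δ σ) e i
    lights = filter (∁? heavies) (allFin n)

    few-heavies : length (filter heavies (allFin n)) ≤ r * (s σ ∸ 1)
    few-heavies = heavy-count {n} col (filter⁺ heavies (allFin⁺ n))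
      (proj₂ ∘ ∈-filter⁻ heavies {xs = allFin n})
      (λ e → <⇒≤pred (few-heavy-classes {n} col {σ = σ} nonMonochromatic e))

    many-lights : s σ ≤ length lights
    many-lights = +-cancelˡ-≤ (r * (s σ ∸ 1)) _ _ (begin
      r * (s σ ∸ 1) + s σ                                ≤⟨ n≥ ⟩
      n                                                  ≡⟨ length-tabulate {n = n} id ⟨
      length (allFin n)                                  ≤⟨ length-filter-split heavies (allFin n) ⟩
      length (filter heavies (allFin n)) + length lights ≤⟨ +-monoˡ-≤ (length lights) few-heavies ⟩
      r * (s σ ∸ 1) + length lights                      ∎)
      where open ≤-Reasoning

    almostFull : ∀ {i} → i ∈ lights → AlmostFull {n} col i
    almostFull {i} i∈ with heavy-or-light {n} col t i
    ... | inj₁ (e , h) = contradiction (e , ≤-trans (≤-reflexive Δ≡) h)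
                                       (proj₂ (∈-filter⁻ (∁? heavies) {xs = allFin n} i∈))
    -- With `r` colours the class size is literally the required `(k ∸ 1) * t`, whence `refl`.
    ... | inj₂ light = light⇒almostFull {n} col 0<t refl light

    edge = rainbow-edge {n} col {σ = σ} 1∈ 2≤s allUsed (fromℕ< {0} (*-mono-< 0<r 0<t))
             (filter⁺ (∁? heavies) (allFin⁺ n)) (All.tabulate almostFull) many-lights

-- Construction of colourings.

module _ {n q r : ℕ} (σ : Partition r) {R : Subset (n * q)} (edge : Edge (ℋ n r q σ) R) where

  part-intersection : ∀ {a} → a ∈ parts σ → ∃[ i ] ∣ R ∩ V n q i ∣ ≡ a
  part-intersection a∈ with ∈-map⁻ (λ i → ∣ R ∩ V n q i ∣)
    (proj₁ (∈-filter⁻ nonZero? {xs = intersectionSizes n q R} (↭.∈-resp-↭ (↭-sym (proj₂ edge)) a∈)))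
  ... | i , _ , eq = i , sym eq

  metClasses : List (Fin n)
  metClasses = filter (λ i → nonZero? ∣ R ∩ V n q i ∣) (allFin n)

  length-metClasses : length metClasses ≡ s σ
  length-metClasses = begin
    length metClasses                                ≡⟨ length-map _ metClasses ⟨
    length (map (λ i → ∣ R ∩ V n q i ∣) metClasses)  ≡⟨ cong length (filter-map nonZero? _ (allFin n)) ⟨
    length (filter nonZero? (intersectionSizes n q R)) ≡⟨ ↭.↭-length (proj₂ edge) ⟩
    s σ                                              ∎
    where open ≡-Reasoning

  metClasses-met : ∀ {i} → i ∈ metClasses → ∃[ v ] v Subset.∈ R × quotient q v ≡ i
  metClasses-met {i} i∈ with proj₂ (∈-filter⁻ (λ i → nonZero? ∣ R ∩ V n q i ∣) {xs = allFin n} i∈)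
  ... | nz with nonempty-of-nonZero {S = R ∩ V n q i} nz
  ...   | v , v∈ = v , proj₁ (x∈p∩q⁻ R _ v∈) , ∈V⁻ (proj₂ (x∈p∩q⁻ R _ v∈))

-- Edges have `suc r` vertices here, and a position in a class is a pair of a colour in `Fin r` and
-- a copy in `Fin t`. A rainbow edge would inject its `suc r` vertices into `r` colours; a
-- monochromatic one would inject `suc t` vertices of one class into `t` copies.
balanced-colouring : ∀ {n r t} {σ : Partition (suc r)} → suc t ∈ parts σ → Fin n → Fin t →
                     NMNRColourable r (ℋ n (suc r) (r * t) σ)
balanced-colouring {n} {r} {t} {σ} Δ∈ i₀ j₀ = c , record
  { allUsed = λ d → combine i₀ (combine d j₀) , λ { refl → c-combine d }
  ; nonMonochromatic = nonMono
  ; nonRainbow = λ R (∣R∣ , _) rainbow → 1+n≰n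
      (≤-trans (≤-reflexive (sym (trans (length-elements R) ∣R∣)))
        (length≤codomain {f = c} (λ x∈ y∈ → rainbow _ _ (∈-elements⁻ x∈) (∈-elements⁻ y∈)) (elements-unique R)))
  }
  where
  c : Fin (n * (r * t)) → Fin r
  c v = quotient t (remainder {n} (r * t) v)

  c-combine : ∀ d → c (combine i₀ (combine d j₀)) ≡ d
  c-combine d = trans (cong (quotient t ∘ proj₂) (Fin.remQuot-combine {n} i₀ (combine d j₀)))
                      (cong proj₁ (Fin.remQuot-combine d j₀))

  nonMono : ∀ R → Edge (ℋ n (suc r) (r * t) σ) R → ¬ Monochromatic c R
  nonMono R edge mono with part-intersection {n} {r * t} σ {R} edge Δ∈
  ... | i , eq = 1+n≰n (≤-trans (≤-reflexive (sym (trans (length-elements (R ∩ V n (r * t) i)) eq)))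
    (length≤codomain {f = λ v → remainder {r} t (remainder {n} (r * t) v)} inj
      (elements-unique (R ∩ V n (r * t) i))))
    where
    split : ∀ {v} → v ∈ elements (R ∩ V n (r * t) i) → v Subset.∈ R × quotient (r * t) v ≡ i
    split v∈ = let v∈R , v∈V = x∈p∩q⁻ R (V n (r * t) i) (∈-elements⁻ v∈) in v∈R , ∈V⁻ v∈V

    inj : ∀ {x y} → x ∈ elements (R ∩ V n (r * t) i) → y ∈ elements (R ∩ V n (r * t) i) →
          remainder {r} t (remainder {n} (r * t) x) ≡ remainder {r} t (remainder {n} (r * t) y) → x ≡ y
    inj x∈ y∈ eq = let x∈R , x∈i = split x∈ ; y∈R , y∈i = split y∈ in
      remQuot-injective {n} (trans x∈i (sym y∈i)) (remQuot-injective {r} (mono _ _ x∈R y∈R) eq)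

-- The class number is `k` times a quotient below `suc u` plus a remainder, the colour; so at most
-- `suc u` classes share a colour. An edge meets one class more, hence is not monochromatic, and its
-- part `a` puts two vertices of equal colour in one class.
classwise-colouring : ∀ {n r q k u a} {σ : Partition r} → s σ ≡ suc (suc u) → a ∈ parts σ → 2 ≤ a → Fin q →
                      k ≤ n → n ≤ suc u * k → NMNRColourable k (ℋ n r q σ)
classwise-colouring {n} {r} {q} {k} {u} {a} {σ} s≡ a∈ 2≤a j₀ k≤n n≤ = c , record
  { allUsed = λ d → combine (inject≤ d k≤n) j₀ , λ { refl → c-combine d }
  ; nonMonochromatic = nonMono
  ; nonRainbow = nonRain
  }
  where
  classColour : Fin n → Fin k
  classColour i = remainder {suc u} k (inject≤ i n≤)

  c : Fin (n * q) → Fin k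
  c v = classColour (quotient q v)

  c-combine : ∀ d → c (combine (inject≤ d k≤n) j₀) ≡ d
  c-combine d = trans (cong classColour (quotient-combine (inject≤ d k≤n) j₀))
    (trans (cong (remainder {suc u} k) inject≡combine) (cong proj₂ (Fin.remQuot-combine {suc u} zero d)))
    where
    -- The first `k` classes have quotient `zero`, so class `d` has colour `d`; surjectivity rests
    -- on this.
    inject≡combine : inject≤ (inject≤ d k≤n) n≤ ≡ combine {suc u} zero d
    inject≡combine = Fin.toℕ-injective (trans (Fin.toℕ-inject≤ (inject≤ d k≤n) n≤)
      (trans (Fin.toℕ-inject≤ d k≤n) (sym (Fin.toℕ-↑ˡ d (u * k)))))

  nonMono : ∀ R → Edge (ℋ n r q σ) R → ¬ Monochromatic c R
  nonMono R edge mono = 1+n≰n (≤-trans (≤-reflexive (sym (trans (length-metClasses {n} {q} σ {R} edge) s≡)))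
    (length≤codomain {f = λ i → quotient {suc u} k (inject≤ i n≤)} inj
      (filter⁺ (λ i → nonZero? ∣ R ∩ V n q i ∣) (allFin⁺ n))))
    where
    inj : ∀ {x y} → x ∈ metClasses {n} {q} σ {R} edge → y ∈ metClasses {n} {q} σ {R} edge →
          quotient {suc u} k (inject≤ x n≤) ≡ quotient k (inject≤ y n≤) → x ≡ y
    inj x∈ y∈ eq with metClasses-met {n} {q} σ {R} edge x∈ | metClasses-met {n} {q} σ {R} edge y∈
    ... | v , v∈ , v-in-x | w , w∈ , w-in-y =
      Fin.inject≤-injective n≤ n≤ _ _ (remQuot-injective {suc u} eq
        (trans (sym (cong classColour v-in-x)) (trans (mono v w v∈ w∈) (cong classColour w-in-y))))

  nonRain : ∀ R → Edge (ℋ n r q σ) R → ¬ Rainbow c R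
  nonRain R edge rainbow with part-intersection {n} {q} σ {R} edge a∈
  ... | i , eq with two-elements {S = R ∩ V n q i} (subst (2 ≤_) (sym eq) 2≤a)
  ...   | v , w , v∈ , w∈ , v≢w =
    let v∈R , v∈V = x∈p∩q⁻ R (V n q i) v∈
        w∈R , w∈V = x∈p∩q⁻ R (V n q i) w∈
    in v≢w (rainbow v w v∈R w∈R (cong classColour (trans (∈V⁻ v∈V) (sym (∈V⁻ w∈V)))))

-- Extremal parts and assembly of the spectrum.

Δ∈parts : ∀ {r} {σ : Partition r} → 0 < Δ σ → Δ σ ∈ parts σ
Δ∈parts {σ = σ} 0<Δ with argmax-sel id 0 (parts σ)
-- Positivity excludes the default `0` of `max`.
... | inj₁ Δ≡0 = contradiction 0<Δ (<-irrefl (sym Δ≡0))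
... | inj₂ Δ∈  = Δ∈

δ∈parts : ∀ {r} {σ : Partition r} → δ σ < r → δ σ ∈ parts σ
δ∈parts {r} {σ} δ<r with argmin-sel id r (parts σ)
-- The bound `δ σ < r` excludes the default `r` of `min`.
... | inj₁ δ≡r = contradiction δ<r (<-irrefl δ≡r)
... | inj₂ δ∈  = δ∈

theorem3p2 :
    (r : ℕ) → 3 ≤ r →
    (σ : Partition r) (2≤s : 2 ≤ s σ) → δ σ ≡ 1 → 1 < Δ σ →
    (n : ℕ) → r * (s σ ∸ 1) + s σ < n →
    let q = (r ∸ 1) * (Δ σ ∸ 1)
        H = ℋ n r q σ
        b = ⌈_/_⌉ n (s σ ∸ 1) {{n≥2⇒n∸1-nonZero 2≤s}}
    in GapBetween H (r ∸ 1) b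
       × (∀ k → 1 ≤ k → k ≤ r ∸ 2 → ¬ NMNRColourable k H)
       × NMNRColourable (r ∸ 1) H
       × ¬ NMNRColourable r H
       × (∀ k → b ≤ k → k ≤ n → NMNRColourable k H)
theorem3p2 r@(suc r′@(suc r″)) 3≤r σ 2≤s δ≡1 1<Δ n n> =
    ( (s≤s z≤n , at-r′)
    , (≤-trans (s≤s z≤n) r<b , above b ≤-refl (⌈m/d⌉≤m n d))
    -- The value missing from the spectrum is `r` itself.
    , r , ≤-refl , r<b , at-r ∘ proj₂)
  -- Here `r ∸ 2` has reduced to `r″`, so `s≤s k≤` reads `k < r ∸ 1`.
  , (λ k _ k≤ → not-colourable-below {σ = σ} Δ≡ (s≤s k≤) 0<t (below k≤))
  , at-r′
  , at-r
  , above
  where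
  t = Δ σ ∸ 1
  d = s σ ∸ 1
  instance
    d-nonZero : NonZero d
    d-nonZero = n≥2⇒n∸1-nonZero 2≤s
    n-nonZero : NonZero n
    n-nonZero = >-nonZero (≤-<-trans z≤n n>)
  b = ⌈ n / d ⌉
  H = ℋ n r (r′ * t) σ

  0<t : 0 < t
  0<t = m<n⇒0<n∸m 1<Δ

  Δ≡ : Δ σ ≡ suc t
  Δ≡ = sym (m+[n∸m]≡n (<⇒≤ 1<Δ))

  Δ∈ : Δ σ ∈ parts σ
  Δ∈ = Δ∈parts {σ = σ} (<⇒≤ 1<Δ)

  1∈ : 1 ∈ parts σ
  1∈ = subst (_∈ parts σ) δ≡1 (δ∈parts {σ = σ} (subst (_< r) (sym δ≡1) (≤-trans (s≤s (s≤s z≤n)) 3≤r)))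

  rd<n : r * d < n
  rd<n = ≤-<-trans (m≤m+n (r * d) (s σ)) n>

  -- From `r * d < n` and `n ≤ b * d` the factor `d` cancels.
  r<b : r < b
  r<b = *-cancelʳ-< d r b (<-≤-trans rd<n (m≤⌈m/d⌉*d n d))

  below : ∀ {k} → k ≤ r″ → k * d < n
  below k≤ = ≤-<-trans (*-monoˡ-≤ d (≤-trans k≤ (m≤n+m r″ 2))) rd<n

  at-r′ : NMNRColourable r′ H
  at-r′ = balanced-colouring {σ = σ} (subst (_∈ parts σ) Δ≡ Δ∈) (fromℕ< {0} (>-nonZero⁻¹ n)) (fromℕ< 0<t)

  at-r : ¬ NMNRColourable r H
  at-r = not-colourable-at {σ = σ} Δ≡ 0<t (s≤s z≤n) 1∈ 2≤s (<⇒≤ n>)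

  s≡ : s σ ≡ 2 + (s σ ∸ 2)
  s≡ = sym (m+[n∸m]≡n 2≤s)

  above : ∀ k → b ≤ k → k ≤ n → NMNRColourable k H
  above k b≤k k≤n = classwise-colouring {σ = σ} s≡ Δ∈ 1<Δ j₀ k≤n (begin
    n                       ≤⟨ m≤⌈m/d⌉*d n d ⟩
    b * d                   ≤⟨ *-monoˡ-≤ d b≤k ⟩
    k * d                   ≡⟨ *-comm k d ⟩
    d * k                   ≡⟨ cong (λ m → (m ∸ 1) * k) s≡ ⟩
    suc (s σ ∸ 2) * k       ∎)
    where
    open ≤-Reasoning
    j₀ = fromℕ< {0} (*-mono-< {0} {r′} {0} {t} (s≤s z≤n) 0<t)
theorem3p2 1 (s≤s ())
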